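{- No quiver in the mutation class of $E_8^{(1,1)}$ has an admissible vector.
   Context: $E_8^{(1,1)}$ is the exceptional mutation-finite quiver (in the classification of Felikson–Shapiro–Tumarkin / Derksen–Owen) given by: vertices $a,b$ with a double arrow $a\Rightarrow b$; three vertices $x_1,x_2,x_3$, each with arrows $b\to x_i$ and $x_i\to a$; and pendant paths (single arrows, any orientation) attached at the $x_i$ so that the three "legs" starting at $x_1,x_2,x_3$ have $2,1,5$ vertices respectively (10 vertices in total). Quivers have no loops/2-cycles; $b_{ij}$ is the number of arrows $v_i\to v_j$ (negative if reversed); mutation $\mu_k$: $b'_{ij}=-b_{ij}$ if $k\in\{i,j\}$, else $b'_{ij}=b_{ij}+\mathrm{sgn}(b_{ik})[b_{ik}b_{kj}]_+$. For a quiver $Q$ on mutable vertices $v_1,\dots,v_n$ and $\boldsymbol b\in\mathbb Z^n$, add a frozen vertex $q$ with $b_i$ arrows from $v_i$ to $q$; mutations only at mutable vertices. $\boldsymbol b$ is admissible if $\boldsymbol b\neq0$ and the resulting quiver with frozen vertex has finite mutation class. -}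

module Defs where

open import Data.Nat using (ℕ; zero; suc)
open import Data.Integer using (ℤ; +_; -[1+_]; _+_; _-_; _*_; -_)
open import Data.Fin using (Fin; zero; suc; toℕ; _≟_)
open import Data.Fin.Permutation using (Permutation′; _⟨$⟩ʳ_)
open import Data.List using (List)
open import Data.List.Relation.Unary.Any using (Any)
open import Data.Product using (∃; Σ; _×_)
open import Data.Empty using (⊥)
open import Data.Unit using (⊤)
open import Relation.Nullary using (¬_; yes; no)
open import Relation.Binary.PropositionalEquality using (_≡_)

-- A quiver (without loops / 2-cycles) on vertices Fin n, encoded by its
-- skew-symmetric exchange matrix: B i j = number of arrows i → j
-- (negative if the arrows go j → i).
Mat : ℕ → Set
Mat n = Fin n → Fin n → ℤ

pos : ℤ → ℤ
pos (+ n)    = + n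
pos -[1+ n ] = + 0

sgn : ℤ → ℤ
sgn (+ zero)  = + 0
sgn (+ suc n) = + 1
sgn -[1+ n ]  = - (+ 1)

mutate : ∀ {n} → Fin n → Mat n → Mat n
mutate k B i j with i ≟ k | j ≟ k
... | yes _ | _     = - B i j
... | no _  | yes _ = - B i j
... | no _  | no _  = B i j + sgn (B i k) * pos (B i k * B k j)

data MutReach {n} (P : Fin n → Set) (B : Mat n) : Mat n → Set where
  here : MutReach P B B
  step : ∀ {C} (k : Fin n) → P k → MutReach P B C → MutReach P B (mutate k C)

FiniteMutClass : ∀ {n} → (Fin n → Set) → Mat n → Set
FiniteMutClass {n} P B =
  Σ (List (Mat n)) λ L → ∀ C → MutReach P B C →
    Any (λ M → ∀ i j → M i j ≡ C i j) L

allVertices : ∀ {n} → Fin n → Set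
allVertices _ = ⊤

-- The quiver E_8^{(1,1)}.  Labelling: 0 = a, 1 = b, 2 = x1, 3 = x2, 4 = x3,
-- 5 = second vertex of the leg at x1, 6,7,8,9 = the remaining vertices of
-- the leg at x3 (leg at x2 is just x2).  Legs: 2,1,5 vertices.
-- arrows u v = number of arrows u → v.
arrows : ℕ → ℕ → ℤ
arrows 0 1 = + 2
arrows 1 2 = + 1
arrows 1 3 = + 1
arrows 1 4 = + 1
arrows 2 0 = + 1
arrows 3 0 = + 1
arrows 4 0 = + 1
arrows 2 5 = + 1
arrows 4 6 = + 1
arrows 6 7 = + 1
arrows 7 8 = + 1
arrows 8 9 = + 1
arrows _ _ = + 0

E811 : Mat 10
E811 i j = arrows (toℕ i) (toℕ j) - arrows (toℕ j) (toℕ i)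

InMutClassE811 : Mat 10 → Set
InMutClassE811 Q =
  Σ (Permutation′ 10) λ π →
    MutReach allVertices E811 (λ i j → Q (π ⟨$⟩ʳ i) (π ⟨$⟩ʳ j))

-- Extension of Q on n mutable vertices by a frozen vertex q (= zero);
-- mutable vertex v_i is suc i; b_i arrows v_i → q.
extend : ∀ {n} → Mat n → (Fin n → ℤ) → Mat (suc n)
extend Q b zero    zero    = + 0
extend Q b zero    (suc j) = - b j
extend Q b (suc i) zero    = b i
extend Q b (suc i) (suc j) = Q i j

Mutable : ∀ {n} → Fin (suc n) → Set
Mutable zero    = ⊥
Mutable (suc _) = ⊤

Admissible : ∀ {n} → Mat n → (Fin n → ℤ) → Set
Admissible Q b = (¬ (∀ i → b i ≡ + 0)) × FiniteMutClass Mutable (extend Q b)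

{-# OPTIONS --safe #-}

-- A finite mutation class bounds the frozen vector b along all mutations.  At a
-- double arrow s ⇒ t, alternating mutations at s and t make b grow linearly unless
-- b s ≤ 0 ≤ b t.  This applies to the double arrow 0 ⇒ 1 of E811 and to the double
-- arrow 1 ⇒ 8 which appears after fourteen mutations.  Writing the value at each
-- mutated vertex as p - n with p, n ≥ 0 and p n = 0, the first condition forces
-- enough signs for the final value at vertex 1 to be a sum of p's and n's; being
-- nonpositive it is 0, so these p's and n's vanish, and then so does b.

module Submission where

open import Defs
open import Data.Bool using (if_then_else_; _∧_)
open import Data.Empty using (⊥-elim)
open import Data.Fin using (Fin; zero; suc; toℕ; _≟_; #_)
open import Data.Fin.Permutation using (_⟨$⟩ʳ_; _⟨$⟩ˡ_; inverseˡ; inverseʳ)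
open import Data.Fin.Properties using (all?)
open import Data.Integer using (ℤ; +_; -[1+_]; _+_; _-_; _*_; -_; ∣_∣)
open import Data.Integer.Properties
  using ( +-identityˡ; +-identityʳ; +-injective; *-zeroʳ; *-identityˡ; -1*i≡-i; neg-involutive
        ; neg-injective; neg-distribˡ-*; neg-distribʳ-*; pos-*; ∣-i∣≡∣i∣ )
  renaming (_≟_ to _≟ℤ_)
open import Data.Integer.Solver using (module +-*-Solver)
open import Data.List using (List; []; _∷_; map)
open import Data.List.Relation.Unary.Any using (Any; here; there)
open import Data.Nat as ℕ using (ℕ; zero; suc; _≤_; _≡ᵇ_)
import Data.Nat.Properties as ℕₚ
open import Data.Product using (∃; ∃₂; _×_; _,_; proj₁; proj₂)
open import Data.Unit using (tt)
open import Data.Vec using (Vec; []; _∷_; lookup; sum; tabulate)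
open import Data.Vec.Properties using (lookup∘tabulate)
open import Data.Vec.Relation.Unary.All using (All; []; _∷_)
open import Data.Vec.Relation.Unary.All.Properties using (lookup⁺)
open import Function using (id; _∘_)
open import Function.Definitions using (Injective)
open import Relation.Binary.PropositionalEquality
open import Relation.Nullary using (¬_; Dec; yes; no)
open import Relation.Nullary.Decidable using (from-yes)
open +-*-Solver

Vector : ℕ → Set
Vector n = Fin n → ℤ

mutateVec : ∀ {n} → Fin n → Mat n → Vector n → Vector n
mutateVec k Q b i with i ≟ k
... | yes _ = - b i
... | no _  = b i + sgn (Q i k) * pos (Q i k * b k)

frozenAfter : ∀ {n} → List (Fin n) → Mat n → Vector n → Vector n
frozenAfter []       Q b = b
frozenAfter (k ∷ ks) Q b = frozenAfter ks (mutate k Q) (mutateVec k Q b)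

Bounded : ∀ {n} → ℕ → Mat n → Vector n → Set
Bounded {n} N Q b = ∀ ks i → ∣ frozenAfter {n} ks Q b i ∣ ≤ N

-- Restriction to full subquivers and relabelling.

module _ {m n} (f : Fin m → Fin n) (f-inj : Injective _≡_ _≡_ f) where

  -- Mutation at a vertex of a full subquiver changes the entries between its vertices using only
  -- such entries; injectivity of `f` makes the case distinctions on both sides agree.
  mutate-restrict : ∀ k {Q′ : Mat m} {Q : Mat n} → (∀ i j → Q′ i j ≡ Q (f i) (f j)) →
                    ∀ i j → mutate k Q′ i j ≡ mutate (f k) Q (f i) (f j)
  mutate-restrict k eq i j with i ≟ k | j ≟ k | f i ≟ f k | f j ≟ f k
  ... | yes _  | _      | yes _   | _       = cong -_ (eq i j)
  ... | yes ik | _      | no fik  | _       = ⊥-elim (fik (cong f ik))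
  ... | no ik  | _      | yes fik | _       = ⊥-elim (ik (f-inj fik))
  ... | no _   | yes _  | no _    | yes _   = cong -_ (eq i j)
  ... | no _   | yes jk | no _    | no fjk  = ⊥-elim (fjk (cong f jk))
  ... | no _   | no jk  | no _    | yes fjk = ⊥-elim (jk (f-inj fjk))
  ... | no _   | no _   | no _    | no _
    rewrite eq i j | eq i k | eq k j = refl

  mutateVec-restrict : ∀ k {Q′ : Mat m} {Q : Mat n} {b′ b} →
    (∀ i j → Q′ i j ≡ Q (f i) (f j)) → (∀ i → b′ i ≡ b (f i)) →
    ∀ i → mutateVec k Q′ b′ i ≡ mutateVec (f k) Q b (f i)
  mutateVec-restrict k eq eqb i with i ≟ k | f i ≟ f k
  ... | yes _  | yes _   = cong -_ (eqb i)
  ... | yes ik | no fik  = ⊥-elim (fik (cong f ik))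
  ... | no ik  | yes fik = ⊥-elim (ik (f-inj fik))
  ... | no _   | no _ rewrite eq i k | eqb i | eqb k = refl

  frozenAfter-restrict : ∀ ks {Q′ : Mat m} {Q : Mat n} {b′ b} →
    (∀ i j → Q′ i j ≡ Q (f i) (f j)) → (∀ i → b′ i ≡ b (f i)) →
    ∀ i → frozenAfter ks Q′ b′ i ≡ frozenAfter (map f ks) Q b (f i)
  frozenAfter-restrict []       eq eqb = eqb
  frozenAfter-restrict (k ∷ ks) eq eqb =
    frozenAfter-restrict ks (mutate-restrict k eq) (mutateVec-restrict k eq eqb)

  Bounded-restrict : ∀ {N} {Q′ : Mat m} {Q : Mat n} {b′ b} →
    (∀ i j → Q′ i j ≡ Q (f i) (f j)) → (∀ i → b′ i ≡ b (f i)) →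
    Bounded N Q b → Bounded N Q′ b′
  Bounded-restrict {N} eq eqb bd ks i =
    subst (λ z → ∣ z ∣ ≤ N) (sym (frozenAfter-restrict ks eq eqb i)) (bd (map f ks) (f i))

Bounded-resp : ∀ {n N} {Q′ Q : Mat n} {b′ b} →
  (∀ i j → Q′ i j ≡ Q i j) → (∀ i → b′ i ≡ b i) → Bounded N Q b → Bounded N Q′ b′
Bounded-resp = Bounded-restrict id id

Bounded-mutate : ∀ {n N} k {Q : Mat n} {b} →
  Bounded N Q b → Bounded N (mutate k Q) (mutateVec k Q b)
Bounded-mutate k bd ks = bd (k ∷ ks)

-- Undoing a mutation.

mutate-row : ∀ {n} k (Q : Mat n) j → mutate k Q k j ≡ - Q k j
mutate-row k Q j with k ≟ k | j ≟ k
... | yes _ | _ = refl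
... | no kk | _ = ⊥-elim (kk refl)

mutate-column : ∀ {n} k (Q : Mat n) i → mutate k Q i k ≡ - Q i k
mutate-column k Q i with i ≟ k | k ≟ k
... | yes _ | _     = refl
... | no _  | yes _ = refl
... | no _  | no kk = ⊥-elim (kk refl)

mutate-other : ∀ {n} k (Q : Mat n) {i j} → i ≢ k → j ≢ k →
               mutate k Q i j ≡ Q i j + sgn (Q i k) * pos (Q i k * Q k j)
mutate-other k Q {i} {j} ik jk with i ≟ k | j ≟ k
... | yes p | _     = ⊥-elim (ik p)
... | no _  | yes p = ⊥-elim (jk p)
... | no _  | no _  = refl

sgn-neg : ∀ x → sgn (- x) ≡ - sgn x
sgn-neg (+ zero)  = refl
sgn-neg (+ suc _) = refl
sgn-neg -[1+ _ ]  = refl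

-- Away from `k`, the second mutation sees both `Q i k` and `Q k j` negated: their product is
-- unchanged while the sign in front flips, so the two corrections cancel.
mutate-involutive : ∀ {n} k (Q : Mat n) i j → mutate k (mutate k Q) i j ≡ Q i j
mutate-involutive k Q i j = by-cases (i ≟ k) (j ≟ k)
  where
  by-cases : Dec (i ≡ k) → Dec (j ≡ k) → mutate k (mutate k Q) i j ≡ Q i j
  by-cases (yes refl) _
    rewrite mutate-row k (mutate k Q) j | mutate-row k Q j = neg-involutive (Q k j)
  by-cases (no _) (yes refl)
    rewrite mutate-column k (mutate k Q) i | mutate-column k Q i = neg-involutive (Q i k)
  by-cases (no ik) (no jk)
    rewrite mutate-other k (mutate k Q) ik jk | mutate-other k Q ik jk
          | mutate-column k Q i | mutate-row k Q j | sgn-neg (Q i k)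
          | solve 2 (λ x y → (:- x) :* (:- y) := x :* y) refl (Q i k) (Q k j)
    = solve 3 (λ x s p → (x :+ s :* p) :+ (:- s) :* p := x) refl
        (Q i j) (sgn (Q i k)) (pos (Q i k * Q k j))

-- The value at `k` is merely negated, hence zero, and then the correction at every other vertex is
-- zero too.
mutateVec-injective-at-0 : ∀ {n} k (Q : Mat n) b →
  (∀ i → mutateVec k Q b i ≡ + 0) → ∀ i → b i ≡ + 0
mutateVec-injective-at-0 k Q b eq i = at-any (eq i)
  where
  -x≡0⇒x≡0 : ∀ {x} → - x ≡ + 0 → x ≡ + 0
  -x≡0⇒x≡0 {x} e = trans (sym (neg-involutive x)) (cong -_ e)

  at-k : b k ≡ + 0
  at-k with eq k
  ... | e with k ≟ k
  ...   | yes _ = -x≡0⇒x≡0 e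
  ...   | no kk = ⊥-elim (kk refl)

  at-any : mutateVec k Q b i ≡ + 0 → b i ≡ + 0
  at-any e with i ≟ k
  ... | yes _ = -x≡0⇒x≡0 e
  ... | no _ rewrite at-k | *-zeroʳ (Q i k) | *-zeroʳ (sgn (Q i k)) | +-identityʳ (b i) = e

-- Comparing the rows of mutable vertices suffices: mutation at a mutable vertex computes these rows
-- from these rows alone.
RealisedIn : ∀ {n} → Mat (suc n) → Mat n → Vector n → Set
RealisedIn D Q b = (∀ i j → D (suc i) (suc j) ≡ Q i j) × (∀ i → D (suc i) zero ≡ b i)

RealisedIn-mutate : ∀ {n} k {D} {Q : Mat n} {b} → RealisedIn D Q b →
                    RealisedIn (mutate (suc k) D) (mutate k Q) (mutateVec k Q b)
RealisedIn-mutate k {D} {Q} {b} (eq , eqb) = eq′ , eqb′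
  where
  eq′ : ∀ i j → mutate (suc k) D (suc i) (suc j) ≡ mutate k Q i j
  eq′ i j with i ≟ k | j ≟ k
  ... | yes _ | _     = cong -_ (eq i j)
  ... | no _  | yes _ = cong -_ (eq i j)
  ... | no _  | no _ rewrite eq i j | eq i k | eq k j = refl

  eqb′ : ∀ i → mutate (suc k) D (suc i) zero ≡ mutateVec k Q b i
  eqb′ i with i ≟ k
  ... | yes _ = cong -_ (eqb i)
  ... | no _ rewrite eqb i | eq i k | eqb k = refl

-- Generalised to a matrix `D` already reached, because `step` appends a mutation at the end while
-- `frozenAfter` consumes the list from the front.
frozenAfter-reached : ∀ {n} ks {B D} {Q : Mat n} {b} →
  MutReach Mutable B D → RealisedIn D Q b →
  ∃ λ D′ → MutReach Mutable B D′ × (∀ i → D′ (suc i) zero ≡ frozenAfter ks Q b i)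
frozenAfter-reached []       r (_ , eqb) = _ , r , eqb
frozenAfter-reached (k ∷ ks) r re =
  frozenAfter-reached ks (step (suc k) tt r) (RealisedIn-mutate k re)

upperBound : ∀ {n} (f : Fin n → ℕ) → ∃ λ N → ∀ i → f i ≤ N
upperBound {zero}  f = 0 , λ ()
upperBound {suc n} f with upperBound (f ∘ suc)
... | N , f≤N = f zero ℕ.+ N , λ where
  zero    → ℕₚ.m≤m+n _ _
  (suc i) → ℕₚ.≤-trans (f≤N i) (ℕₚ.m≤n+m _ _)

-- The bound is chosen before `P`, so a single `N` serves every reachable matrix.
upperBoundList : ∀ {a p n} {A : Set a} (f : A → Fin n → ℕ) (xs : List A) →
  ∃ λ N → {P : A → Set p} → Any P xs → ∃ λ x → P x × (∀ i → f x i ≤ N)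
upperBoundList f []       = 0 , λ ()
upperBoundList f (x ∷ xs) with upperBound (f x) | upperBoundList f xs
... | M , fx≤M | N , rest = M ℕ.+ N , λ where
  (here px)  → x , px , λ i → ℕₚ.≤-trans (fx≤M i) (ℕₚ.m≤m+n _ _)
  (there ys) → let y , py , fy≤N = rest ys in
               y , py , λ i → ℕₚ.≤-trans (fy≤N i) (ℕₚ.m≤n+m _ _)

finite⇒Bounded : ∀ {n} {Q : Mat n} {b} →
                 FiniteMutClass Mutable (extend Q b) → ∃ λ N → Bounded N Q b
finite⇒Bounded (L , complete)
  with upperBoundList (λ M i → ∣ M (suc i) zero ∣) L
... | N , upper = N , λ ks i →
  let D , reached , D≡ = frozenAfter-reached ks here ((λ _ _ → refl) , (λ _ → refl))
      M , M≡D , M≤N    = upper (complete D reached)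
  in subst (λ z → ∣ z ∣ ≤ N) (trans (M≡D (suc i) zero) (D≡ i)) (M≤N i)

-- Positive and negative parts, which make the mutation rule linear.

-- The constructors overlap only at zero, where both parts are 0. As a relation it keeps the parts
-- as variables until a sign becomes known.
data Parts : ℤ → ℕ → ℕ → Set where
  nonneg : ∀ m → Parts (+ m) m 0
  nonpos : ∀ m → Parts (- + m) 0 m

parts : ∀ v → ∃₂ (Parts v)
parts (+ m)    = m , 0 , nonneg m
parts -[1+ m ] = 0 , suc m , nonpos (suc m)

Parts-difference : ∀ {v p n} → Parts v p n → v ≡ + p - + n
Parts-difference (nonneg m) = sym (+-identityʳ (+ m))
Parts-difference (nonpos m) = sym (+-identityˡ (- + m))

+m≡-n⇒m≡0×n≡0 : ∀ {m n} → + m ≡ - + n → m ≡ 0 × n ≡ 0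
+m≡-n⇒m≡0×n≡0 {m} {zero}  e = +-injective e , refl
+m≡-n⇒m≡0×n≡0 {m} {suc n} ()

Parts-of-nonneg : ∀ {v p n m} → Parts v p n → v ≡ + m → p ≡ m × n ≡ 0
Parts-of-nonneg (nonneg _) e = +-injective e , refl
Parts-of-nonneg (nonpos _) e with +m≡-n⇒m≡0×n≡0 (sym e)
... | refl , refl = refl , refl

Parts-of-nonpos : ∀ {v p n m} → Parts v p n → v ≡ - + m → p ≡ 0 × n ≡ m
Parts-of-nonpos (nonpos _) e = refl , +-injective (neg-injective e)
Parts-of-nonpos (nonneg _) e with +m≡-n⇒m≡0×n≡0 e
... | refl , refl = refl , refl

-- Stated by iterated addition so that for entries 0 and ±1 it evaluates to
-- x, x + p and x - n on the nose.
shift : ℤ → ℕ → ℕ → ℤ → ℤ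
shift (+ zero)     p n x = x
shift (+ suc e)    p n x = shift (+ e) p n x + + p
shift -[1+ zero ]  p n x = x - + n
shift -[1+ suc e ] p n x = shift -[1+ e ] p n x - + n

shift-+ : ∀ e p n x → shift (+ e) p n x ≡ x + + (e ℕ.* p)
shift-+ zero    p n x = sym (+-identityʳ x)
shift-+ (suc e) p n x rewrite shift-+ e p n x =
  solve 3 (λ x p q → (x :+ q) :+ p := x :+ (p :+ q)) refl x (+ p) (+ (e ℕ.* p))

shift-- : ∀ e p n x → shift -[1+ e ] p n x ≡ x - + (suc e ℕ.* n)
shift-- zero    p n x rewrite ℕₚ.+-identityʳ n = refl
shift-- (suc e) p n x rewrite shift-- e p n x =
  solve 3 (λ x n q → (x :- q) :- n := x :- (n :+ q)) refl x (+ n) (+ (suc e ℕ.* n))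

pos-neg : ∀ m → pos (- + m) ≡ + 0
pos-neg zero    = refl
pos-neg (suc m) = refl

-- For `e` positive only the positive part of `v` survives `pos`, contributing `e` times `p`; for
-- `e` negative only the negative part does, and the sign in front makes it a subtraction.
shift-Parts : ∀ e x {v p n} → Parts v p n → shift e p n x ≡ x + sgn e * pos (e * v)
shift-Parts (+ zero)  x P = sym (+-identityʳ x)
shift-Parts (+ suc e) x (nonneg m)
  rewrite shift-+ (suc e) m 0 x | sym (pos-* (suc e) m) | *-identityˡ (+ (suc e ℕ.* m)) = refl
shift-Parts (+ suc e) x (nonpos m)
  rewrite shift-+ (suc e) 0 m x | sym (neg-distribʳ-* (+ suc e) (+ m)) | sym (pos-* (suc e) m)
        | pos-neg (suc e ℕ.* m) | ℕₚ.*-zeroʳ e = refl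
shift-Parts -[1+ e ]  x (nonneg m)
  rewrite shift-- e m 0 x | sym (neg-distribˡ-* (+ suc e) (+ m)) | sym (pos-* (suc e) m)
        | pos-neg (suc e ℕ.* m) | ℕₚ.*-zeroʳ e = refl
shift-Parts -[1+ e ]  x (nonpos m)
  rewrite shift-- e 0 m x
        | solve 2 (λ e m → (:- e) :* (:- m) := e :* m) refl (+ suc e) (+ m)
        | sym (pos-* (suc e) m) | -1*i≡-i (+ (suc e ℕ.* m)) = refl

mutateParts : ∀ {n} → Fin n → Mat n → ℕ → ℕ → Vector n → Vector n
mutateParts k Q p n b i with i ≟ k
... | yes _ = + n - + p
... | no _  = shift (Q i k) p n (b i)

mutateParts-correct : ∀ {m} k (Q : Mat m) {p n} b → Parts (b k) p n →
                      ∀ i → mutateParts k Q p n b i ≡ mutateVec k Q b i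
mutateParts-correct k Q {p} {n} b P i with i ≟ k
... | yes refl rewrite Parts-difference P =
  solve 2 (λ p n → n :- p := :- (p :- n)) refl (+ p) (+ n)
... | no _     = shift-Parts (Q i k) (b i) P

-- Continuation-passing form for chaining mutations: `Q′` replaces the mutated quiver by an explicit
-- one, so that matrix entries do not become nested mutations.
Bounded-step : ∀ {n N a} {A : Set a} k {Q Q′ : Mat n} {b} →
  (∀ i j → Q′ i j ≡ mutate k Q i j) → Bounded N Q b →
  (∀ {p n} → Parts (b k) p n → Bounded N Q′ (mutateParts k Q p n b) → A) → A
Bounded-step k {Q} {b = b} eq bd cont with parts (b k)
... | p , n , P = cont P (Bounded-resp eq (mutateParts-correct k Q b P) (Bounded-mutate k bd))

-- Sign conditions at a double arrow.

kronecker : Mat 2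
kronecker i j = lookup (lookup ((+ 0 ∷ + 2 ∷ []) ∷ (- + 2 ∷ + 0 ∷ []) ∷ []) i) j

⟨_,_⟩ : ℤ → ℤ → Vector 2
⟨ x , y ⟩ i = lookup (x ∷ y ∷ []) i

swap₂ : Fin 2 → Fin 2
swap₂ zero       = suc zero
swap₂ (suc zero) = zero

swap₂-injective : Injective _≡_ _≡_ swap₂
swap₂-injective {zero}     {zero}     _ = refl
swap₂-injective {zero}     {suc zero} ()
swap₂-injective {suc zero} {zero}     ()
swap₂-injective {suc zero} {suc zero} _ = refl

-- Mutation at the source reverses the double arrow; swapping the two vertices restores its shape,
-- with the old target as new source, so the step can be iterated.
kronecker-step : ∀ {N x y} → Bounded N kronecker ⟨ x , y ⟩ →
  ∃₂ λ p n → Parts x p n × Bounded N kronecker ⟨ y - + n - + n , + n - + p ⟩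
kronecker-step bd = Bounded-step zero (λ _ _ → refl) bd λ P bd′ →
  _ , _ , P , Bounded-restrict swap₂ swap₂-injective
  (λ where zero       zero       → refl
           zero       (suc zero) → refl
           (suc zero) zero       → refl
           (suc zero) (suc zero) → refl)
  (λ where zero       → refl
           (suc zero) → refl) bd′

-- While the value at the source is nonpositive the sum of the two values is
-- invariant, so a negative sum drags the value at the source to -∞.
kronecker-diverges : ∀ {N} m r → ¬ Bounded N kronecker ⟨ - + m , + m - + suc r ⟩
kronecker-diverges {N} m r bd with iterate (suc N)
  where
  iterate : ∀ t → ∃ λ m → t ≤ m × Bounded N kronecker ⟨ - + m , + m - + suc r ⟩
  iterate zero    = m , ℕ.z≤n , bd
  iterate (suc t) with iterate t
  ... | m , t≤m , bd′ with kronecker-step bd′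
  ...   | p , n , P , bd″ with Parts-of-nonpos P refl
  -- The sum of the values stays `- + suc r`, and `m` grows by `suc r`, hence by at least one per
  -- step.
  ...     | refl , refl = m ℕ.+ suc r , suc-bound ,
    Bounded-resp (λ _ _ → refl)
      (λ where
        zero       → solve 2 (λ m r → :- (m :+ r) := m :- r :- m :- m) refl (+ m) (+ suc r)
        (suc zero) → solve 2 (λ m r → m :+ r :- r := m :- con (+ 0)) refl (+ m) (+ suc r))
      bd″
    where
    suc-bound : suc t ≤ m ℕ.+ suc r
    suc-bound rewrite ℕₚ.+-suc m r = ℕ.s≤s (ℕₚ.≤-trans t≤m (ℕₚ.m≤m+n m r))
... | m′ , N<m′ , bd′ =
  ℕₚ.<⇒≱ N<m′ (subst (_≤ N) (∣-i∣≡∣i∣ (+ m′)) (bd′ [] zero))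

kronecker-diverges′ : ∀ {N} m r {x y} → x ≡ - + m → y ≡ + m - + suc r →
                      ¬ Bounded N kronecker ⟨ x , y ⟩
kronecker-diverges′ m r refl refl = kronecker-diverges m r

-- A nonnegative value at the source adds nothing to the other vertex: it is negated and the roles
-- swap. At most two such steps turn every excluded sign pattern into a nonpositive source value
-- with negative sum, which diverges.
kronecker-signs : ∀ {N} x y → Bounded N kronecker ⟨ x , y ⟩ →
                  (∃ λ m → x ≡ - + m) × (∃ λ m → y ≡ + m)
kronecker-signs (+ zero)  (+ m)    bd = (0 , refl) , (m , refl)
kronecker-signs -[1+ k ]  (+ m)    bd = (suc k , refl) , (m , refl)
kronecker-signs (+ zero)  -[1+ r ] bd = ⊥-elim (kronecker-diverges′ 0 r refl refl bd)
kronecker-signs -[1+ k ]  -[1+ r ] bd =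
  ⊥-elim (kronecker-diverges′ (suc k) (suc k ℕ.+ r) refl
    (solve 2 (λ k r → :- (con (+ 1) :+ r) := con (+ 1) :+ k :- (con (+ 1) :+ (con (+ 1) :+ k :+ r)))
       refl (+ k) (+ r)) bd)
kronecker-signs (+ suc k) y bd with kronecker-step bd
... | p , n , P , bd′ with Parts-of-nonneg P refl
kronecker-signs (+ suc k) -[1+ r ] bd | _ , _ , _ , bd′ | refl , refl =
  ⊥-elim (kronecker-diverges′ (suc r) (suc r ℕ.+ k) refl
    (solve 2 (λ k r → con (+ 0) :- (con (+ 1) :+ k) :=
                      con (+ 1) :+ r :- (con (+ 1) :+ (con (+ 1) :+ r :+ k))) refl (+ k) (+ r)) bd′)
kronecker-signs (+ suc k) (+ m) bd | _ , _ , _ , bd′ | refl , refl with kronecker-step bd′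
... | p , n , P , bd″ with Parts-of-nonneg P refl
...   | refl , refl =
  ⊥-elim (kronecker-diverges′ (suc k) (k ℕ.+ m) refl
    (solve 2 (λ k m → con (+ 0) :- (m :+ con (+ 0) :+ con (+ 0)) :=
                      con (+ 1) :+ k :- (con (+ 1) :+ (k :+ m))) refl (+ k) (+ m)) bd″)

doubleArrow-signs : ∀ {n N} {Q : Mat n} {b} (f : Fin 2 → Fin n) → Injective _≡_ _≡_ f →
  (∀ i j → kronecker i j ≡ Q (f i) (f j)) → Bounded N Q b →
  (∃ λ m → b (f zero) ≡ - + m) × (∃ λ m → b (f (suc zero)) ≡ + m)
doubleArrow-signs f f-inj eq bd = kronecker-signs _ _ (Bounded-restrict f f-inj eq
  (λ where zero       → refl
           (suc zero) → refl) bd)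

-- The explicit mutation sequence.

_⟶_ : ℕ → ℕ → ℕ × ℕ
_⟶_ = _,_

countArrows : ℕ → ℕ → List (ℕ × ℕ) → ℕ
countArrows u v []             = 0
countArrows u v ((s , t) ∷ as) =
  if (u ≡ᵇ s) ∧ (v ≡ᵇ t) then suc (countArrows u v as) else countArrows u v as

quiver : ∀ {n} → List (ℕ × ℕ) → Mat n
quiver as i j = + countArrows (toℕ i) (toℕ j) as - + countArrows (toℕ j) (toℕ i) as

-- The quivers obtained from E811 by mutating successively at the vertices
-- 2, 6, 4, 7, 3, 1, 0, 8, 5, 1, 3, 7, 6, 9.
Q₁ : Mat 10
Q₁ = quiver
  ( (0 ⟶ 1) ∷ (0 ⟶ 2) ∷ (1 ⟶ 3) ∷ (1 ⟶ 4) ∷ (1 ⟶ 5) ∷ (2 ⟶ 1) ∷ (3 ⟶ 0)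
  ∷ (4 ⟶ 0) ∷ (4 ⟶ 6) ∷ (5 ⟶ 2) ∷ (6 ⟶ 7) ∷ (7 ⟶ 8) ∷ (8 ⟶ 9) ∷ [] )

Q₂ : Mat 10
Q₂ = quiver
  ( (0 ⟶ 1) ∷ (0 ⟶ 2) ∷ (1 ⟶ 3) ∷ (1 ⟶ 4) ∷ (1 ⟶ 5) ∷ (2 ⟶ 1) ∷ (3 ⟶ 0) ∷ (4 ⟶ 0)
  ∷ (4 ⟶ 7) ∷ (5 ⟶ 2) ∷ (6 ⟶ 4) ∷ (7 ⟶ 6) ∷ (7 ⟶ 8) ∷ (8 ⟶ 9) ∷ [] )

Q₃ : Mat 10
Q₃ = quiver
  ( (0 ⟶ 2) ∷ (0 ⟶ 4) ∷ (1 ⟶ 3) ∷ (1 ⟶ 5) ∷ (1 ⟶ 7) ∷ (2 ⟶ 1) ∷ (3 ⟶ 0) ∷ (4 ⟶ 1)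
  ∷ (4 ⟶ 6) ∷ (5 ⟶ 2) ∷ (6 ⟶ 0) ∷ (7 ⟶ 4) ∷ (7 ⟶ 8) ∷ (8 ⟶ 9) ∷ [] )

Q₄ : Mat 10
Q₄ = quiver
  ( (0 ⟶ 2) ∷ (0 ⟶ 4) ∷ (1 ⟶ 3) ∷ (1 ⟶ 5) ∷ (1 ⟶ 8) ∷ (2 ⟶ 1) ∷ (3 ⟶ 0) ∷ (4 ⟶ 6)
  ∷ (4 ⟶ 7) ∷ (5 ⟶ 2) ∷ (6 ⟶ 0) ∷ (7 ⟶ 1) ∷ (8 ⟶ 7) ∷ (8 ⟶ 9) ∷ [] )

Q₅ : Mat 10
Q₅ = quiver
  ( (0 ⟶ 2) ∷ (0 ⟶ 3) ∷ (0 ⟶ 4) ∷ (1 ⟶ 0) ∷ (1 ⟶ 5) ∷ (1 ⟶ 8) ∷ (2 ⟶ 1) ∷ (3 ⟶ 1)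
  ∷ (4 ⟶ 6) ∷ (4 ⟶ 7) ∷ (5 ⟶ 2) ∷ (6 ⟶ 0) ∷ (7 ⟶ 1) ∷ (8 ⟶ 7) ∷ (8 ⟶ 9) ∷ [] )

Q₆ : Mat 10
Q₆ = quiver
  ( (0 ⟶ 1) ∷ (0 ⟶ 4) ∷ (1 ⟶ 2) ∷ (1 ⟶ 3) ∷ (1 ⟶ 7) ∷ (2 ⟶ 8) ∷ (3 ⟶ 5) ∷ (3 ⟶ 8) ∷ (4 ⟶ 6)
  ∷ (4 ⟶ 7) ∷ (5 ⟶ 1) ∷ (6 ⟶ 0) ∷ (7 ⟶ 0) ∷ (7 ⟶ 5) ∷ (8 ⟶ 1) ∷ (8 ⟶ 9) ∷ [] )

Q₇ : Mat 10
Q₇ = quiver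
  ( (0 ⟶ 6) ∷ (0 ⟶ 7) ∷ (1 ⟶ 0) ∷ (1 ⟶ 2) ∷ (1 ⟶ 3) ∷ (2 ⟶ 8) ∷ (3 ⟶ 5) ∷ (3 ⟶ 8)
  ∷ (4 ⟶ 0) ∷ (5 ⟶ 1) ∷ (6 ⟶ 1) ∷ (7 ⟶ 5) ∷ (8 ⟶ 1) ∷ (8 ⟶ 9) ∷ [] )

Q₈ : Mat 10
Q₈ = quiver
  ( (0 ⟶ 6) ∷ (0 ⟶ 7) ∷ (1 ⟶ 0) ∷ (1 ⟶ 8) ∷ (2 ⟶ 9) ∷ (3 ⟶ 5) ∷ (3 ⟶ 9) ∷ (4 ⟶ 0)
  ∷ (5 ⟶ 1) ∷ (6 ⟶ 1) ∷ (7 ⟶ 5) ∷ (8 ⟶ 2) ∷ (8 ⟶ 3) ∷ (9 ⟶ 8) ∷ [] )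

Q₉ : Mat 10
Q₉ = quiver
  ( (0 ⟶ 6) ∷ (0 ⟶ 7) ∷ (1 ⟶ 0) ∷ (1 ⟶ 5) ∷ (1 ⟶ 8) ∷ (2 ⟶ 9) ∷ (3 ⟶ 1) ∷ (3 ⟶ 9) ∷ (4 ⟶ 0)
  ∷ (5 ⟶ 3) ∷ (5 ⟶ 7) ∷ (6 ⟶ 1) ∷ (7 ⟶ 1) ∷ (8 ⟶ 2) ∷ (8 ⟶ 3) ∷ (9 ⟶ 8) ∷ [] )

Q₁₀ : Mat 10
Q₁₀ = quiver
  ( (0 ⟶ 1) ∷ (1 ⟶ 3) ∷ (1 ⟶ 6) ∷ (1 ⟶ 7) ∷ (2 ⟶ 9) ∷ (3 ⟶ 0) ∷ (3 ⟶ 9) ∷ (4 ⟶ 0)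
  ∷ (5 ⟶ 1) ∷ (6 ⟶ 5) ∷ (6 ⟶ 8) ∷ (7 ⟶ 8) ∷ (8 ⟶ 1) ∷ (8 ⟶ 2) ∷ (9 ⟶ 8) ∷ [] )

Q₁₁ : Mat 10
Q₁₁ = quiver
  ( (0 ⟶ 3) ∷ (1 ⟶ 6) ∷ (1 ⟶ 7) ∷ (1 ⟶ 9) ∷ (2 ⟶ 9) ∷ (3 ⟶ 1) ∷ (4 ⟶ 0) ∷ (5 ⟶ 1)
  ∷ (6 ⟶ 5) ∷ (6 ⟶ 8) ∷ (7 ⟶ 8) ∷ (8 ⟶ 1) ∷ (8 ⟶ 2) ∷ (9 ⟶ 3) ∷ (9 ⟶ 8) ∷ [] )

Q₁₂ : Mat 10
Q₁₂ = quiver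
  ( (0 ⟶ 3) ∷ (1 ⟶ 6) ∷ (1 ⟶ 9) ∷ (2 ⟶ 9) ∷ (3 ⟶ 1) ∷ (4 ⟶ 0) ∷ (5 ⟶ 1) ∷ (6 ⟶ 5)
  ∷ (6 ⟶ 8) ∷ (7 ⟶ 1) ∷ (8 ⟶ 2) ∷ (8 ⟶ 7) ∷ (9 ⟶ 3) ∷ (9 ⟶ 8) ∷ [] )

Q₁₃ : Mat 10
Q₁₃ = quiver
  ( (0 ⟶ 3) ∷ (1 ⟶ 8) ∷ (1 ⟶ 9) ∷ (2 ⟶ 9) ∷ (3 ⟶ 1) ∷ (4 ⟶ 0) ∷ (5 ⟶ 6) ∷ (6 ⟶ 1)
  ∷ (7 ⟶ 1) ∷ (8 ⟶ 2) ∷ (8 ⟶ 6) ∷ (8 ⟶ 7) ∷ (9 ⟶ 3) ∷ (9 ⟶ 8) ∷ [] )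

Q₁₄ : Mat 10
Q₁₄ = quiver
  ( (0 ⟶ 3) ∷ (1 ⟶ 8) ∷ (1 ⟶ 8) ∷ (2 ⟶ 3) ∷ (3 ⟶ 9) ∷ (4 ⟶ 0) ∷ (5 ⟶ 6) ∷ (6 ⟶ 1)
  ∷ (7 ⟶ 1) ∷ (8 ⟶ 6) ∷ (8 ⟶ 7) ∷ (8 ⟶ 9) ∷ (9 ⟶ 1) ∷ (9 ⟶ 2) ∷ [] )

-- Sign analysis along the sequence.

sum≡0⇒All≡0 : ∀ {n} (ns : Vec ℕ n) → sum ns ≡ 0 → All (_≡ 0) ns
sum≡0⇒All≡0 []       _ = []
sum≡0⇒All≡0 (n ∷ ns) e = ℕₚ.m+n≡0⇒m≡0 n e ∷ sum≡0⇒All≡0 ns (ℕₚ.m+n≡0⇒n≡0 n e)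

Parts-0-0 : ∀ {v} → Parts v 0 0 → v ≡ + 0
Parts-0-0 (nonneg _) = refl
Parts-0-0 (nonpos _) = refl

isMutation? : ∀ {n} k (Q Q′ : Mat n) → Dec (∀ i j → Q′ i j ≡ mutate k Q i j)
isMutation? k Q Q′ = all? λ i → all? λ j → Q′ i j ≟ℤ mutate k Q i j

isKronecker? : ∀ {n} (Q : Mat n) (f : Fin 2 → Fin n) →
               Dec (∀ i j → kronecker i j ≡ Q (f i) (f j))
isKronecker? Q f = all? λ i → all? λ j → kronecker i j ≟ℤ Q (f i) (f j)

edge : ∀ {n} → Fin n → Fin n → Fin 2 → Fin n
edge a c zero       = a
edge a c (suc zero) = c

edge-injective : ∀ {n} {a c : Fin n} → a ≢ c → Injective _≡_ _≡_ (edge a c)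
edge-injective a≢c {zero}     {zero}     _ = refl
edge-injective a≢c {zero}     {suc zero} e = ⊥-elim (a≢c e)
edge-injective a≢c {suc zero} {zero}     e = ⊥-elim (a≢c (sym e))
edge-injective a≢c {suc zero} {suc zero} _ = refl

-- p and n with index d are the positive and negative parts of the value at the
-- vertex mutated in step d; the last two hypotheses are the values at the ends
-- of the final double arrow.  That at its source is a sum of natural numbers.
signs⇒vanishing : ∀ {c c′ s t z₂ z₃ z₄ z₅ z₆ z₇ z₈ z₉
    p₀ n₀ p₁ n₁ p₂ n₂ p₃ n₃ p₄ n₄ p₅ n₅ p₆ n₆
    p₇ n₇ p₈ n₈ p₉ n₉ p₁₀ n₁₀ p₁₁ n₁₁ p₁₂ n₁₂ p₁₃ n₁₃} →
  Parts z₂ p₀ n₀ →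
  Parts z₆ p₁ n₁ →
  Parts (z₄ + + p₁) p₂ n₂ →
  Parts (z₇ - + n₁ - + n₂) p₃ n₃ →
  Parts z₃ p₄ n₄ →
  Parts (+ c + + p₀ + + p₂ + + p₃ + + p₄) p₅ n₅ →
  Parts (- + c′ - + n₀ - + n₂ - + n₄ - + n₅) p₆ n₆ →
  Parts (z₈ - + n₃ - + n₅) p₇ n₇ →
  Parts (z₅ - + n₀ - + n₅) p₈ n₈ →
  Parts (+ n₅ - + p₅ - + n₆ - + n₇ - + n₈) p₉ n₉ →
  Parts (+ n₄ - + p₄ + + p₅ + + p₇ + + p₈ + + p₉) p₁₀ n₁₀ →
  Parts (+ n₃ - + p₃ + + p₅ + + p₆ + + p₈ + + p₉) p₁₁ n₁₁ →
  Parts (+ n₁ - + p₁ + + p₂ + + p₆ + + p₉) p₁₂ n₁₂ →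
  Parts (z₉ - + n₇ - + n₁₀) p₁₃ n₁₃ →
  + n₉ - + p₉ + + p₁₀ + + p₁₁ + + p₁₂ + + p₁₃ ≡ - + s →
  + n₇ - + p₇ - + n₉ - + n₁₁ - + n₁₂ - + n₁₃ ≡ + t →
  All (_≡ + 0) (- + c′ ∷ + c ∷ z₂ ∷ z₃ ∷ z₄ ∷ z₅ ∷ z₆ ∷ z₇ ∷ z₈ ∷ z₉ ∷ [])
signs⇒vanishing {c} {c′} {s} {t} {z₂} {z₃} {z₄} {z₅} {z₆} {z₇} {z₈} {z₉}
    {p₀} {n₀} {p₁} {n₁} {p₂} {n₂} {p₃} {n₃} {p₄} {n₄} {p₅} {n₅} {p₆} {n₆}
    {p₇} {n₇} {p₈} {n₈} {p₉} {n₉} {p₁₀} {n₁₀} {p₁₁} {n₁₁} {p₁₂} {n₁₂} {p₁₃} {n₁₃}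
    P₀ P₁ P₂ P₃ P₄ P₅ P₆ P₇ P₈ P₉ P₁₀ P₁₁ P₁₂ P₁₃ source target
  -- The signs at the first double arrow enter here: the values `+ c` and `- + c′` fix the signs in
  -- `P₅` and `P₆`, and these in turn fix the sign in `P₉`.
  with Parts-of-nonneg {m = sum (c ∷ p₀ ∷ p₂ ∷ p₃ ∷ p₄ ∷ [])} P₅
    (solve 5 (λ c p₀ p₂ p₃ p₄ → c :+ p₀ :+ p₂ :+ p₃ :+ p₄
        := c :+ (p₀ :+ (p₂ :+ (p₃ :+ (p₄ :+ con (+ 0)))))) refl
      (+ c) (+ p₀) (+ p₂) (+ p₃) (+ p₄))
... | p₅≡ , refl
  with Parts-of-nonpos {m = sum (c′ ∷ n₀ ∷ n₂ ∷ n₄ ∷ [])} P₆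
    (solve 4 (λ c′ n₀ n₂ n₄ → :- c′ :- n₀ :- n₂ :- n₄ :- con (+ 0)
        := :- (c′ :+ (n₀ :+ (n₂ :+ (n₄ :+ con (+ 0)))))) refl
      (+ c′) (+ n₀) (+ n₂) (+ n₄))
... | refl , n₆≡
  with Parts-of-nonpos {m = sum (p₅ ∷ n₆ ∷ n₇ ∷ n₈ ∷ [])} P₉
    (solve 4 (λ p₅ n₆ n₇ n₈ → con (+ 0) :- p₅ :- n₆ :- n₇ :- n₈
        := :- (p₅ :+ (n₆ :+ (n₇ :+ (n₈ :+ con (+ 0)))))) refl
      (+ p₅) (+ n₆) (+ n₇) (+ n₈))
... | refl , n₉≡
  -- Expanding `p₅` cancels the negative term: its summand `p₄` does so here, and its summand `p₃`
  -- in `P₁₁`.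
  with Parts-of-nonneg {m = sum (c ∷ p₀ ∷ p₂ ∷ p₃ ∷ n₄ ∷ p₇ ∷ p₈ ∷ [])} P₁₀
    (trans (cong (λ p₅ → + n₄ - + p₄ + + p₅ + + p₇ + + p₈ + + 0) p₅≡)
    (solve 8 (λ c p₀ p₂ p₃ p₄ n₄ p₇ p₈ →
        n₄ :- p₄ :+ (c :+ (p₀ :+ (p₂ :+ (p₃ :+ (p₄ :+ con (+ 0)))))) :+ p₇ :+ p₈ :+ con (+ 0)
        := c :+ (p₀ :+ (p₂ :+ (p₃ :+ (n₄ :+ (p₇ :+ (p₈ :+ con (+ 0)))))))) refl
      (+ c) (+ p₀) (+ p₂) (+ p₃) (+ p₄) (+ n₄) (+ p₇) (+ p₈)))
... | p₁₀≡ , refl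
  with Parts-of-nonneg {m = sum (c ∷ p₀ ∷ p₂ ∷ n₃ ∷ p₄ ∷ p₈ ∷ [])} P₁₁
    (trans (cong (λ p₅ → + n₃ - + p₃ + + p₅ + + 0 + + p₈ + + 0) p₅≡)
    (solve 7 (λ c p₀ p₂ p₃ p₄ n₃ p₈ →
        n₃ :- p₃ :+ (c :+ (p₀ :+ (p₂ :+ (p₃ :+ (p₄ :+ con (+ 0)))))) :+ con (+ 0) :+ p₈ :+ con (+ 0)
        := c :+ (p₀ :+ (p₂ :+ (n₃ :+ (p₄ :+ (p₈ :+ con (+ 0))))))) refl
      (+ c) (+ p₀) (+ p₂) (+ p₃) (+ p₄) (+ n₃) (+ p₈)))
... | p₁₁≡ , refl
  with sum≡0⇒All≡0 (n₉ ∷ p₁₀ ∷ p₁₁ ∷ p₁₂ ∷ p₁₃ ∷ []) (proj₁ (+m≡-n⇒m≡0×n≡0 (trans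
    (solve 5 (λ n₉ p₁₀ p₁₁ p₁₂ p₁₃ → n₉ :+ (p₁₀ :+ (p₁₁ :+ (p₁₂ :+ (p₁₃ :+ con (+ 0)))))
        := n₉ :- con (+ 0) :+ p₁₀ :+ p₁₁ :+ p₁₂ :+ p₁₃) refl
      (+ n₉) (+ p₁₀) (+ p₁₁) (+ p₁₂) (+ p₁₃)) source)))
... | refl ∷ refl ∷ refl ∷ refl ∷ refl ∷ []
  -- The vanishing of `n₉`, `p₁₀` and `p₁₁` passes to their summands, and that of `n₆` then to `c′`,
  -- `n₀` and `n₂`.
  with sum≡0⇒All≡0 (p₅ ∷ n₆ ∷ n₇ ∷ n₈ ∷ []) (sym n₉≡)
     | sum≡0⇒All≡0 (c ∷ p₀ ∷ p₂ ∷ p₃ ∷ n₄ ∷ p₇ ∷ p₈ ∷ []) (sym p₁₀≡)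
     | sum≡0⇒All≡0 (c ∷ p₀ ∷ p₂ ∷ n₃ ∷ p₄ ∷ p₈ ∷ []) (sym p₁₁≡)
... | refl ∷ refl ∷ refl ∷ refl ∷ [] | refl ∷ refl ∷ refl ∷ refl ∷ refl ∷ refl ∷ refl ∷ []
    | _ ∷ _ ∷ _ ∷ refl ∷ refl ∷ _ ∷ []
  with sum≡0⇒All≡0 (c′ ∷ n₀ ∷ n₂ ∷ 0 ∷ []) (sym n₆≡)
... | refl ∷ refl ∷ refl ∷ _ ∷ []
  -- The target value has shrunk to minus the sum of `n₁₂` and `n₁₃`, yet it is nonnegative.
  with sum≡0⇒All≡0 (n₁₂ ∷ n₁₃ ∷ []) (proj₂ (+m≡-n⇒m≡0×n≡0 (trans (sym target)
    (solve 2 (λ n₁₂ n₁₃ → con (+ 0) :- n₁₂ :- n₁₃ := :- (n₁₂ :+ (n₁₃ :+ con (+ 0)))) refl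
      (+ n₁₂) (+ n₁₃)))))
... | refl ∷ refl ∷ []
  -- Only `p₁` and `n₁` remain. Both parts in `P₁₂` are 0, so their difference vanishes, and `P₁`
  -- then makes each of them 0.
  with trans (solve 2 (λ p₁ n₁ → p₁ :- n₁ :=
                         :- (n₁ :- p₁ :+ con (+ 0) :+ con (+ 0) :+ con (+ 0))) refl (+ p₁) (+ n₁))
             (cong -_ (Parts-0-0 P₁₂))
... | v₁≡0
  with Parts-of-nonneg P₁ (trans (Parts-difference P₁) v₁≡0)
... | refl , refl = refl ∷ refl ∷ Parts-0-0 P₀ ∷ Parts-0-0 P₄
  ∷ drop₁ (Parts-0-0 P₂) ∷ drop₂ (Parts-0-0 P₈) ∷ Parts-0-0 P₁ ∷ drop₂ (Parts-0-0 P₃)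
  ∷ drop₂ (Parts-0-0 P₇) ∷ drop₂ (Parts-0-0 P₁₃) ∷ []
  where
  drop₁ : ∀ {z} → z + + 0 ≡ + 0 → z ≡ + 0
  drop₁ {z} = trans (sym (+-identityʳ z))
  drop₂ : ∀ {z} → z + + 0 + + 0 ≡ + 0 → z ≡ + 0
  drop₂ = drop₁ ∘ drop₁

-- The fourteen mutations, decided entry by entry and kept abstract against unfolding.

abstract

  μ₀ : ∀ i j → Q₁ i j ≡ mutate (# 2) E811 i j
  μ₀ = from-yes (isMutation? (# 2) E811 Q₁)

  μ₁ : ∀ i j → Q₂ i j ≡ mutate (# 6) Q₁ i j
  μ₁ = from-yes (isMutation? (# 6) Q₁ Q₂)

  μ₂ : ∀ i j → Q₃ i j ≡ mutate (# 4) Q₂ i j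
  μ₂ = from-yes (isMutation? (# 4) Q₂ Q₃)

  μ₃ : ∀ i j → Q₄ i j ≡ mutate (# 7) Q₃ i j
  μ₃ = from-yes (isMutation? (# 7) Q₃ Q₄)

  μ₄ : ∀ i j → Q₅ i j ≡ mutate (# 3) Q₄ i j
  μ₄ = from-yes (isMutation? (# 3) Q₄ Q₅)

  μ₅ : ∀ i j → Q₆ i j ≡ mutate (# 1) Q₅ i j
  μ₅ = from-yes (isMutation? (# 1) Q₅ Q₆)

  μ₆ : ∀ i j → Q₇ i j ≡ mutate (# 0) Q₆ i j
  μ₆ = from-yes (isMutation? (# 0) Q₆ Q₇)

  μ₇ : ∀ i j → Q₈ i j ≡ mutate (# 8) Q₇ i j
  μ₇ = from-yes (isMutation? (# 8) Q₇ Q₈)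

  μ₈ : ∀ i j → Q₉ i j ≡ mutate (# 5) Q₈ i j
  μ₈ = from-yes (isMutation? (# 5) Q₈ Q₉)

  μ₉ : ∀ i j → Q₁₀ i j ≡ mutate (# 1) Q₉ i j
  μ₉ = from-yes (isMutation? (# 1) Q₉ Q₁₀)

  μ₁₀ : ∀ i j → Q₁₁ i j ≡ mutate (# 3) Q₁₀ i j
  μ₁₀ = from-yes (isMutation? (# 3) Q₁₀ Q₁₁)

  μ₁₁ : ∀ i j → Q₁₂ i j ≡ mutate (# 7) Q₁₁ i j
  μ₁₁ = from-yes (isMutation? (# 7) Q₁₁ Q₁₂)

  μ₁₂ : ∀ i j → Q₁₃ i j ≡ mutate (# 6) Q₁₂ i j
  μ₁₂ = from-yes (isMutation? (# 6) Q₁₂ Q₁₃)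

  μ₁₃ : ∀ i j → Q₁₄ i j ≡ mutate (# 9) Q₁₃ i j
  μ₁₃ = from-yes (isMutation? (# 9) Q₁₃ Q₁₄)

-- Vanishing for `E811` and transport to its mutation class.

E811-vanishing : ∀ {N} z₀ z₁ z₂ z₃ z₄ z₅ z₆ z₇ z₈ z₉ →
  Bounded N E811 (lookup (z₀ ∷ z₁ ∷ z₂ ∷ z₃ ∷ z₄ ∷ z₅ ∷ z₆ ∷ z₇ ∷ z₈ ∷ z₉ ∷ [])) →
  All (_≡ + 0) (z₀ ∷ z₁ ∷ z₂ ∷ z₃ ∷ z₄ ∷ z₅ ∷ z₆ ∷ z₇ ∷ z₈ ∷ z₉ ∷ [])
E811-vanishing _ _ _ _ _ _ _ _ _ _ b₀
  with doubleArrow-signs (edge (# 0) (# 1)) (edge-injective λ ())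
         (from-yes (isKronecker? E811 (edge (# 0) (# 1)))) b₀
-- Since the coordinates are separate variables, matching replaces those at 0 and 1 by a nonpositive
-- and a nonnegative integer.
... | (_ , refl) , (_ , refl) =
  Bounded-step (# 2) μ₀ b₀ λ P₀ b₁ →
  Bounded-step (# 6) μ₁ b₁ λ P₁ b₂ →
  Bounded-step (# 4) μ₂ b₂ λ P₂ b₃ →
  Bounded-step (# 7) μ₃ b₃ λ P₃ b₄ →
  Bounded-step (# 3) μ₄ b₄ λ P₄ b₅ →
  Bounded-step (# 1) μ₅ b₅ λ P₅ b₆ →
  Bounded-step (# 0) μ₆ b₆ λ P₆ b₇ →
  Bounded-step (# 8) μ₇ b₇ λ P₇ b₈ →
  Bounded-step (# 5) μ₈ b₈ λ P₈ b₉ →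
  Bounded-step (# 1) μ₉ b₉ λ P₉ b₁₀ →
  Bounded-step (# 3) μ₁₀ b₁₀ λ P₁₀ b₁₁ →
  Bounded-step (# 7) μ₁₁ b₁₁ λ P₁₁ b₁₂ →
  Bounded-step (# 6) μ₁₂ b₁₂ λ P₁₂ b₁₃ →
  Bounded-step (# 9) μ₁₃ b₁₃ λ P₁₃ b₁₄ →
  let (_ , source) , (_ , target) =
        doubleArrow-signs (edge (# 1) (# 8)) (edge-injective λ ())
          (from-yes (isKronecker? Q₁₄ (edge (# 1) (# 8)))) b₁₄
  -- The values match the hypotheses by evaluation, because all entries in the columns mutated at
  -- are 0 or ±1.
  in signs⇒vanishing P₀ P₁ P₂ P₃ P₄ P₅ P₆ P₇ P₈ P₉ P₁₀ P₁₁ P₁₂ P₁₃ source target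

-- Mutating back at the last vertex gives a bounded vector for the preceding quiver; it vanishes by
-- induction, and mutation sends only the zero vector to zero.
MutReach-vanishing : ∀ {N D} → MutReach allVertices E811 D →
                     ∀ b → Bounded N D b → ∀ i → b i ≡ + 0
MutReach-vanishing here b bd i =
  trans (sym (lookup∘tabulate b i)) (lookup⁺ vanishing i)
  where
  vanishing : All (_≡ + 0) (tabulate b)
  vanishing = E811-vanishing _ _ _ _ _ _ _ _ _ _
    (Bounded-resp (λ _ _ → refl) (lookup∘tabulate b) bd)
MutReach-vanishing (step {C} k _ r) b bd =
  mutateVec-injective-at-0 k (mutate k C) b
    (MutReach-vanishing r _ (Bounded-resp (λ i j → sym (mutate-involutive k C i j)) (λ _ → refl)
      (Bounded-mutate k bd)))

theorem5p3 : (Q : Mat 10) → InMutClassE811 Q → (b : Fin 10 → ℤ) → ¬ Admissible Q b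
theorem5p3 Q (π , r) b (b≢0 , finite) with finite⇒Bounded finite
-- The vector is relabelled along `π` and evaluated at the preimage of `i`.
... | N , bd = b≢0 λ i → subst (λ j → b j ≡ + 0) (inverseʳ π)
  (MutReach-vanishing r (b ∘ (π ⟨$⟩ʳ_))
    (Bounded-restrict (π ⟨$⟩ʳ_) π-injective (λ _ _ → refl) (λ _ → refl) bd) (π ⟨$⟩ˡ i))
  where
  π-injective : Injective _≡_ _≡_ (π ⟨$⟩ʳ_)
  π-injective e = trans (sym (inverseˡ π)) (trans (cong (π ⟨$⟩ˡ_) e) (inverseˡ π))
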